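{- Let $m,n,k,l$ be integers with $1\le k\le \min\{m,n\}$ and $0\le l\le k$. Let $\#(m,n,k,l)$ denote the number of lattice paths $\gamma\in\Gamma_{m,n}$ with $k$-horizontal exceedance $HE_k(\gamma)=l$. Then $$\#(m,n,k,l)=\sum_{j=0}^{k-1} I(\{j\ge l\})\,|B_{(j,k)}(l)|+\sum_{j=0}^{k-1} I(\{j\ge k-l\})\,|B_{(k,j)}(l)|,$$ where $I$ is the indicator function (equal to $1$ if the condition holds and $0$ otherwise) and the numbers $|B_{(k,j)}(l)|$, $|B_{(j,k)}(l)|$ are given by $$|B_{(k,j)}(l)|=\binom{m+n-k-j}{m-k}\sum_{i=k-l}^{j} C_i\, b(k-1-i,\,j-i),\qquad 0\le j<k-1,$$ $$|B_{(j,k)}(l)|=\binom{m+n-k-j}{n-k}\sum_{i=l}^{j} C_i\, b(k-1-i,\,j-i),\qquad 0\le j<k-1,$$ $$|B_{(k-1,k)}(l)|=\binom{m+n-2k+1}{n-k}\,C_{k-1},\qquad |B_{(k,k-1)}(l)|=\binom{m+n-2k+1}{m-k}\,C_{k-1}.$$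
   Context: A lattice path in $\mathbb{N}^2$ (with $0\in\mathbb{N}$) starts at $(0,0)$ and takes unit steps $(1,0)$ (right, a horizontal edge) and $(0,1)$ (up, a vertical edge). $\Gamma_{m,n}$ is the set of lattice paths from $(0,0)$ to $(m,n)$. The $k$-horizontal exceedance $HE_k(\gamma)$ of $\gamma\in\Gamma_{m,n}$ is the number of the first $k$ horizontal edges of $\gamma$ that lie below the line $y=x$ (a horizontal edge from $(a-1,c)$ to $(a,c)$ lies below $y=x$ iff $c\le a-1$). $C_i=\frac{1}{i+1}\binom{2i}{i}$ is the $i$-th Catalan number. For integers $p>q\ge 0$, the ballot number $b(p,q)$ is the number of lattice paths from $(0,0)$ to $(p,q)$ that stay strictly below the line $y=x$ except at $(0,0)$; $b(p,q)=\frac{p-q}{p+q}\binom{p+q}{q}$. Empty sums are $0$. -}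

module Defs where

open import Data.Bool.Base using (if_then_else_)
open import Data.Empty using (⊥)
open import Data.List.Base
  using (List; []; _∷_; [_]; _∷ʳ_; _++_; map; filter; take; length; applyUpTo)
open import Data.List.Membership.Propositional using (_∈_)
open import Data.List.Membership.Propositional.Properties
  using (∈-map⁺; ∈-map⁻; ∈-++⁺ˡ; ∈-++⁺ʳ)
open import Data.List.Relation.Unary.All using (All; []; _∷_; all?)
open import Data.List.Relation.Unary.AllPairs using ([]; _∷_)
open import Data.List.Relation.Unary.Any using (here)
open import Data.List.Relation.Unary.Unique.Propositional using (Unique)
import Data.List.Relation.Unary.Unique.Propositional.Properties as Unique
open import Data.Nat.Base using (ℕ; zero; suc; _+_; _*_; _∸_; _/_; _≤_; _<_)
open import Data.Nat.Combinatorics using (_C_)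
open import Data.Nat.ListAction using (sum)
open import Data.Nat.Properties using (_≟_; _≤?_; _<?_)
open import Data.Product.Base using (_×_; _,_)
open import Level using (0ℓ)
open import Relation.Binary.PropositionalEquality.Core using (_≡_; refl)
open import Relation.Nullary.Decidable using (Dec; does)
open import Relation.Unary using (Pred; Decidable)

-- Γ m n: the lattice paths from (0 , 0) to (m , n).
data Γ : ℕ → ℕ → Set where
  origin  : Γ 0 0
  _▹right : ∀ {m n} → Γ m n → Γ (suc m) n
  _▹up    : ∀ {m n} → Γ m n → Γ m (suc n)

paths : ∀ m n → List (Γ m n)
paths zero    zero    = [ origin ]
paths (suc m) zero    = map _▹right (paths m zero)
paths zero    (suc n) = map _▹up (paths zero n)
paths (suc m) (suc n) = map _▹right (paths m (suc n)) ++ map _▹up (paths (suc m) n)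

-- Every path occurs in paths m n exactly once, so counting along this list
-- is counting elements of Γ m n.
paths-complete : ∀ {m n} (γ : Γ m n) → γ ∈ paths m n
paths-complete origin                        = here refl
paths-complete {suc m} {zero}  (γ ▹right)    = ∈-map⁺ _▹right (paths-complete γ)
paths-complete {suc m} {suc n} (γ ▹right)    = ∈-++⁺ˡ (∈-map⁺ _▹right (paths-complete γ))
paths-complete {zero}  {suc n} (γ ▹up)       = ∈-map⁺ _▹up (paths-complete γ)
paths-complete {suc m} {suc n} (γ ▹up)       =
  ∈-++⁺ʳ (map _▹right (paths m (suc n))) (∈-map⁺ _▹up (paths-complete γ))

paths-unique : ∀ m n → Unique (paths m n)
paths-unique zero    zero    = [] ∷ []
paths-unique (suc m) zero    = Unique.map⁺ (λ { refl → refl }) (paths-unique m zero)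
paths-unique zero    (suc n) = Unique.map⁺ (λ { refl → refl }) (paths-unique zero n)
paths-unique (suc m) (suc n) = Unique.++⁺
  (Unique.map⁺ (λ { refl → refl }) (paths-unique m (suc n)))
  (Unique.map⁺ (λ { refl → refl }) (paths-unique (suc m) n))
  (λ { (r , u) → case-disjoint r u })
  where
  case-disjoint : ∀ {γ} → γ ∈ map _▹right (paths m (suc n)) →
                  γ ∈ map _▹up (paths (suc m) n) → ⊥
  case-disjoint r u with ∈-map⁻ _▹right r | ∈-map⁻ _▹up u
  ... | _ , _ , refl | _ , _ , ()

countPaths : ∀ m n {P : Pred (Γ m n) 0ℓ} → Decidable P → ℕ
countPaths m n P? = length (filter P? (paths m n))

-- The left endpoints of the horizontal edges, in the order of traversal.
horizontalEdges : ∀ {m n} → Γ m n → List (ℕ × ℕ)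
horizontalEdges origin             = []
horizontalEdges {suc m} {n} (γ ▹right) = horizontalEdges γ ∷ʳ (m , n)
horizontalEdges (γ ▹up)            = horizontalEdges γ

-- An edge with left endpoint (x , c) runs from (a - 1 , c) to (a , c) with
-- x = a - 1.
EdgeBelow : Pred (ℕ × ℕ) 0ℓ
EdgeBelow (x , c) = c ≤ x

edgeBelow? : Decidable EdgeBelow
edgeBelow? (x , c) = c ≤? x

HE : ∀ {m n} → ℕ → Γ m n → ℕ
HE k γ = length (filter edgeBelow? (take k (horizontalEdges γ)))

# : (m n k l : ℕ) → ℕ
# m n k l = countPaths m n (λ γ → HE k γ ≟ l)

-- The vertices of a path other than its initial vertex (0 , 0).
laterVertices : ∀ {m n} → Γ m n → List (ℕ × ℕ)
laterVertices origin            = []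
laterVertices {m} {n} (γ ▹right) = laterVertices γ ∷ʳ (m , n)
laterVertices {m} {n} (γ ▹up)    = laterVertices γ ∷ʳ (m , n)

VertexBelow : Pred (ℕ × ℕ) 0ℓ
VertexBelow (x , y) = y < x

StrictlyBelow : ∀ {m n} → Γ m n → Set
StrictlyBelow γ = All VertexBelow (laterVertices γ)

strictlyBelow? : ∀ {m n} → Decidable (StrictlyBelow {m} {n})
strictlyBelow? γ = all? (λ { (x , y) → y <? x }) (laterVertices γ)

-- Ballot numbers; only meaningful for p > q.
b : ℕ → ℕ → ℕ
b p q = countPaths p q strictlyBelow?

-- The division is exact.
catalan : ℕ → ℕ
catalan i = ((2 * i) C i) / suc i

I : ∀ {P : Set} → Dec P → ℕ
I P? = if does P? then 1 else 0

-- ∑[ lo ⋯ hi ] f = f lo + f (lo + 1) + ⋯ + f hi, which is 0 when hi < lo.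
∑[_⋯_] : ℕ → ℕ → (ℕ → ℕ) → ℕ
∑[ lo ⋯ hi ] f = sum (applyUpTo (λ d → f (lo + d)) (suc hi ∸ lo))

-- ∣B⟨k,j⟩∣ and ∣B⟨j,k⟩∣ are used only for j ≤ k - 1 with 1 ≤ k ≤ min(m , n)
-- and l ≤ k; there every truncated subtraction below is a true one, and the
-- else branch is the case j = k - 1.
∣B⟨k,j⟩∣ : (m n k j l : ℕ) → ℕ
∣B⟨k,j⟩∣ m n k j l =
  if does (j <? k ∸ 1)
  then ((m + n ∸ k ∸ j) C (m ∸ k)) * ∑[ k ∸ l ⋯ j ] (λ i → catalan i * b (k ∸ 1 ∸ i) (j ∸ i))
  else ((m + n ∸ 2 * k + 1) C (m ∸ k)) * catalan (k ∸ 1)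

∣B⟨j,k⟩∣ : (m n k j l : ℕ) → ℕ
∣B⟨j,k⟩∣ m n k j l =
  if does (j <? k ∸ 1)
  then ((m + n ∸ k ∸ j) C (n ∸ k)) * ∑[ l ⋯ j ] (λ i → catalan i * b (k ∸ 1 ∸ i) (j ∸ i))
  else ((m + n ∸ 2 * k + 1) C (n ∸ k)) * catalan (k ∸ 1)

{-# OPTIONS --safe #-}
module Submission where

-- Cut a path where it first reaches max (x , y) = k. If this happens at (j , k)
-- with j < k, no later edge among the first k horizontal ones is below the
-- diagonal, so HE k is decided by the prefix to (j , k - 1); if it happens at
-- (k , j), the prefix to (k - 1 , j) followed by one edge below the diagonal
-- decides it. The suffix is free and contributes the binomial coefficient.
-- The prefix is cut again at its last visit (i , i) to the diagonal: the part
-- after it is a ballot path, and by the Chung–Feller theorem exactly catalan i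
-- of the paths to (i , i) have any prescribed number ≤ i of edges above the
-- diagonal. For Chung–Feller, cutting paths to (j + 1 , j + 1) at their
-- previous visit to the diagonal shows inductively that the number with r edges
-- above is the same convolution for every r; as these numbers add up to
-- (2 j + 2) C (j + 1), each is a Catalan number.
-- All cuts are carried out on the recurrences obtained by removing the last step.

open import Defs
open import Data.Bool.Base using (if_then_else_; true; false)
open import Data.List.Base using (List; []; _∷_; _∷ʳ_; _++_; map; filter; take; length; applyUpTo)
open import Data.List.Properties
  using (filter-++; filter-≐; filter-none; length-++; length-map; applyUpTo-∷ʳ; take-all)
import Data.List.Relation.Unary.All as All
open import Data.List.Relation.Unary.All.Properties using (∷ʳ⁺; ∷ʳ⁻)
open import Data.Nat.Base
  using (ℕ; zero; suc; _+_; _*_; _∸_; _/_; _≤_; _<_; _⊓_; z≤n; s≤s; s≤s⁻¹)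
open import Data.Nat.Combinatorics using (_C_; nCn≡1; nCk≡nC[n∸k]; nCk+nC[k+1]≡[n+1]C[k+1])
open import Data.Nat.DivMod using (/-congˡ; m*n/n≡m)
open import Data.Nat.Induction using (<-rec)
open import Data.Nat.ListAction using (sum)
open import Data.Nat.ListAction.Properties using (sum-++)
open import Data.Nat.Properties
open import Algebra.Properties.CommutativeSemigroup +-commutativeSemigroup
  using (xy∙z≈xz∙y) renaming (interchange to +-interchange)
open import Data.Nat.Tactic.RingSolver using (solve-∀)
open import Data.Product.Base using (_,_; proj₁; proj₂)
open import Data.Sum.Base using (_⊎_; inj₁; inj₂)
open import Function.Base using (_∘_)
open import Level using (0ℓ)
open import Relation.Binary.PropositionalEquality
  using (_≡_; refl; sym; trans; cong; cong₂; subst; subst₂; module ≡-Reasoning)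
open import Relation.Nullary.Decidable
  using (Dec; yes; no; does; dec-true; dec-false; ¬?)
open import Relation.Nullary.Negation using (¬_)
open import Relation.Unary using (Pred; Decidable)

open ≡-Reasoning

-- Indicators and finite sums

I-true : {P : Set} (P? : Dec P) → P → I P? ≡ 1
I-true P? p = cong (if_then 1 else 0) (dec-true P? p)

I-false : {P : Set} (P? : Dec P) → ¬ P → I P? ≡ 0
I-false P? ¬p = cong (if_then 1 else 0) (dec-false P? ¬p)

I-true-* : {P : Set} (P? : Dec P) → P → ∀ n → I P? * n ≡ n
I-true-* P? p n = trans (cong (_* n) (I-true P? p)) (*-identityˡ n)

I-false-* : {P : Set} (P? : Dec P) → ¬ P → ∀ n → I P? * n ≡ 0
I-false-* P? ¬p n = cong (_* n) (I-false P? ¬p)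

I-cong : {P Q : Set} (P? : Dec P) (Q? : Dec Q) → (P → Q) → (Q → P) → I P? ≡ I Q?
I-cong P? (yes q) P→Q Q→P = I-true P? (Q→P q)
I-cong P? (no ¬q) P→Q Q→P = I-false P? (¬q ∘ P→Q)

∑-last : ∀ (f : ℕ → ℕ) j → ∑[ 0 ⋯ suc j ] f ≡ ∑[ 0 ⋯ j ] f + f (suc j)
∑-last f j = begin
  sum (applyUpTo f (suc (suc j)))              ≡⟨ cong sum (applyUpTo-∷ʳ f (suc j)) ⟨
  sum (applyUpTo f (suc j) ++ f (suc j) ∷ [])  ≡⟨ sum-++ (applyUpTo f (suc j)) _ ⟩
  ∑[ 0 ⋯ j ] f + (f (suc j) + 0)               ≡⟨ cong (∑[ 0 ⋯ j ] f +_) (+-identityʳ _) ⟩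
  ∑[ 0 ⋯ j ] f + f (suc j)                     ∎

∑-cong : ∀ {f g : ℕ → ℕ} j → (∀ i → i ≤ j → f i ≡ g i) → ∑[ 0 ⋯ j ] f ≡ ∑[ 0 ⋯ j ] g
∑-cong zero    f≗g = cong (_+ 0) (f≗g 0 z≤n)
∑-cong (suc j) f≗g = cong₂ _+_ (f≗g 0 z≤n) (∑-cong j (λ i i≤j → f≗g (suc i) (s≤s i≤j)))

∑-+ : ∀ (f g : ℕ → ℕ) j → ∑[ 0 ⋯ j ] (λ i → f i + g i) ≡ ∑[ 0 ⋯ j ] f + ∑[ 0 ⋯ j ] g
∑-+ f g zero    = +-interchange (f 0) (g 0) 0 0
∑-+ f g (suc j) = trans (cong (f 0 + g 0 +_) (∑-+ (f ∘ suc) (g ∘ suc) j))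
                        (+-interchange (f 0) (g 0) _ _)

∑-const : ∀ c j → ∑[ 0 ⋯ j ] (λ _ → c) ≡ suc j * c
∑-const c zero    = refl
∑-const c (suc j) = cong (c +_) (∑-const c j)

∑-zero : ∀ j → ∑[ 0 ⋯ j ] (λ _ → 0) ≡ 0
∑-zero j = trans (∑-const 0 j) (*-zeroʳ j)

∑-reverse : ∀ (f : ℕ → ℕ) j → ∑[ 0 ⋯ j ] f ≡ ∑[ 0 ⋯ j ] (λ i → f (j ∸ i))
∑-reverse f zero    = refl
∑-reverse f (suc j) = begin
  ∑[ 0 ⋯ suc j ] f                              ≡⟨ ∑-last f j ⟩
  ∑[ 0 ⋯ j ] f + f (suc j)                      ≡⟨ +-comm _ (f (suc j)) ⟩
  f (suc j) + ∑[ 0 ⋯ j ] f                      ≡⟨ cong (f (suc j) +_) (∑-reverse f j) ⟩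
  f (suc j) + ∑[ 0 ⋯ j ] (λ i → f (j ∸ i))      ∎

∑-empty : ∀ {lo hi} (f : ℕ → ℕ) → hi < lo → ∑[ lo ⋯ hi ] f ≡ 0
∑-empty {lo} {hi} f hi<lo = cong (sum ∘ applyUpTo (λ d → f (lo + d))) (m≤n⇒m∸n≡0 hi<lo)

∑-I : ∀ lo (f : ℕ → ℕ) hi → ∑[ 0 ⋯ hi ] (λ i → I (lo ≤? i) * f i) ≡ ∑[ lo ⋯ hi ] f
∑-I zero     f hi       = ∑-cong hi (λ i _ → +-identityʳ (f i))
∑-I (suc lo) f zero     = sym (∑-empty {suc lo} f (s≤s z≤n))
∑-I (suc lo) f (suc hi) = begin
  ∑[ 0 ⋯ hi ] (λ i → I (suc lo ≤? suc i) * f (suc i))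
    ≡⟨ ∑-cong hi (λ i _ → cong (_* f (suc i)) (I-cong (suc lo ≤? suc i) (lo ≤? i) s≤s⁻¹ s≤s)) ⟩
  ∑[ 0 ⋯ hi ] (λ i → I (lo ≤? i) * f (suc i))
    ≡⟨ ∑-I lo (f ∘ suc) hi ⟩
  ∑[ lo ⋯ hi ] (f ∘ suc) ∎

∑-I≟ : ∀ {a} j → a ≤ j → ∑[ 0 ⋯ j ] (λ r → I (a ≟ r)) ≡ 1
∑-I≟ {zero}  zero    _         = refl
∑-I≟ {zero}  (suc j) _         = cong suc (∑-zero j)
∑-I≟ {suc a} (suc j) (s≤s a≤j) =
  trans (∑-cong j (λ r _ → I-cong (suc a ≟ suc r) (a ≟ r) suc-injective (cong suc))) (∑-I≟ j a≤j)

-- Lengths of filtered lists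

module _ {A : Set} where

  length-filter-∷ : ∀ {P : Pred A 0ℓ} (P? : Decidable P) x xs →
                    length (filter P? (x ∷ xs)) ≡ I (P? x) + length (filter P? xs)
  length-filter-∷ P? x xs with does (P? x)
  ... | true  = refl
  ... | false = refl

  length-filter-∷ʳ : ∀ {P : Pred A 0ℓ} (P? : Decidable P) xs x →
                     length (filter P? (xs ∷ʳ x)) ≡ I (P? x) + length (filter P? xs)
  length-filter-∷ʳ P? xs x = begin
    length (filter P? (xs ∷ʳ x))                           ≡⟨ cong length (filter-++ P? xs _) ⟩
    length (filter P? xs ++ filter P? (x ∷ []))            ≡⟨ length-++ (filter P? xs) ⟩
    length (filter P? xs) + length (filter P? (x ∷ []))    ≡⟨ +-comm (length (filter P? xs)) _ ⟩
    length (filter P? (x ∷ [])) + length (filter P? xs)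
      ≡⟨ cong (_+ length (filter P? xs)) (trans (length-filter-∷ P? x []) (+-identityʳ _)) ⟩
    I (P? x) + length (filter P? xs)                       ∎

  length-filter-map : ∀ {B : Set} {P : Pred A 0ℓ} (P? : Decidable P) (f : B → A) xs →
                      length (filter P? (map f xs)) ≡ length (filter (P? ∘ f) xs)
  length-filter-map P? f []       = refl
  length-filter-map P? f (x ∷ xs) with ih ← length-filter-map P? f xs | does (P? (f x))
  ... | true  = cong suc ih
  ... | false = ih

  length-filter-complement : ∀ {P : Pred A 0ℓ} (P? : Decidable P) xs →
    length (filter P? xs) + length (filter (¬? ∘ P?) xs) ≡ length xs
  length-filter-complement P? []       = refl
  length-filter-complement P? (x ∷ xs) with ih ← length-filter-complement P? xs | does (P? x)
  ... | true  = cong suc ih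
  ... | false = trans (+-suc _ _) (cong suc ih)

  take-∷ʳ : ∀ k (xs : List A) x → k ≤ length xs → take k (xs ∷ʳ x) ≡ take k xs
  take-∷ʳ zero    xs       x _         = refl
  take-∷ʳ (suc k) (y ∷ xs) x (s≤s k≤n) = cong (y ∷_) (take-∷ʳ k xs x k≤n)

  ∑-fibres : ∀ (φ : A → ℕ) j → (∀ x → φ x ≤ j) → ∀ xs →
             ∑[ 0 ⋯ j ] (λ r → length (filter (λ x → φ x ≟ r) xs)) ≡ length xs
  ∑-fibres φ j φ≤j []       = ∑-zero j
  ∑-fibres φ j φ≤j (x ∷ xs) = begin
    ∑[ 0 ⋯ j ] (λ r → length (filter (λ y → φ y ≟ r) (x ∷ xs)))
      ≡⟨ ∑-cong j (λ r _ → length-filter-∷ (λ y → φ y ≟ r) x xs) ⟩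
    ∑[ 0 ⋯ j ] (λ r → I (φ x ≟ r) + length (filter (λ y → φ y ≟ r) xs))
      ≡⟨ ∑-+ (λ r → I (φ x ≟ r)) (λ r → length (filter (λ y → φ y ≟ r) xs)) j ⟩
    ∑[ 0 ⋯ j ] (λ r → I (φ x ≟ r)) + ∑[ 0 ⋯ j ] (λ r → length (filter (λ y → φ y ≟ r) xs))
      ≡⟨ cong₂ _+_ (∑-I≟ j (φ≤j x)) (∑-fibres φ j φ≤j xs) ⟩
    suc (length xs) ∎

-- Counting paths by their last step

countPaths-right : ∀ m {P : Pred (Γ (suc m) 0) 0ℓ} (P? : Decidable P) →
                   countPaths (suc m) 0 P? ≡ countPaths m 0 (P? ∘ _▹right)
countPaths-right m P? = length-filter-map P? _▹right (paths m 0)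

countPaths-up : ∀ n {P : Pred (Γ 0 (suc n)) 0ℓ} (P? : Decidable P) →
                countPaths 0 (suc n) P? ≡ countPaths 0 n (P? ∘ _▹up)
countPaths-up n P? = length-filter-map P? _▹up (paths 0 n)

countPaths-last : ∀ m n {P : Pred (Γ (suc m) (suc n)) 0ℓ} (P? : Decidable P) →
  countPaths (suc m) (suc n) P?
    ≡ countPaths m (suc n) (P? ∘ _▹right) + countPaths (suc m) n (P? ∘ _▹up)
countPaths-last m n P? = begin
  length (filter P? (map _▹right ps ++ map _▹up qs))
    ≡⟨ cong length (filter-++ P? (map _▹right ps) _) ⟩
  length (filter P? (map _▹right ps) ++ filter P? (map _▹up qs))
    ≡⟨ length-++ (filter P? (map _▹right ps)) ⟩
  length (filter P? (map _▹right ps)) + length (filter P? (map _▹up qs))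
    ≡⟨ cong₂ _+_ (length-filter-map P? _▹right ps) (length-filter-map P? _▹up qs) ⟩
  countPaths m (suc n) (P? ∘ _▹right) + countPaths (suc m) n (P? ∘ _▹up) ∎
  where
  ps = paths m (suc n)
  qs = paths (suc m) n

countPaths-cong : ∀ {m n} {P Q : Pred (Γ m n) 0ℓ} (P? : Decidable P) (Q? : Decidable Q) →
                  (∀ γ → P γ → Q γ) → (∀ γ → Q γ → P γ) → countPaths m n P? ≡ countPaths m n Q?
countPaths-cong {m} {n} P? Q? P⊆Q Q⊆P =
  cong length (filter-≐ P? Q? ((λ {γ} → P⊆Q γ) , (λ {γ} → Q⊆P γ)) (paths m n))

countPaths-none : ∀ {m n} {P : Pred (Γ m n) 0ℓ} (P? : Decidable P) →
                  (∀ γ → ¬ P γ) → countPaths m n P? ≡ 0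
countPaths-none {m} {n} P? ¬P = cong length (filter-none P? (All.universal ¬P (paths m n)))

countPaths-≗ : ∀ {m n} (φ ψ : Γ m n → ℕ) s → (∀ γ → φ γ ≡ ψ γ) →
               countPaths m n (λ γ → φ γ ≟ s) ≡ countPaths m n (λ γ → ψ γ ≟ s)
countPaths-≗ φ ψ s φ≗ψ = countPaths-cong _ _ (λ γ → trans (sym (φ≗ψ γ))) (λ γ → trans (φ≗ψ γ))

complementary : ∀ {x y N s} → x + y ≡ N → x ≡ s → y ≡ N ∸ s
complementary {x} {y} refl refl = sym (m+n∸m≡n x y)

-- Trades edges above the diagonal for edges below. The bound `s ≤ N` makes `N ∸ s` a true
-- subtraction, from which `s` can be recovered.
countPaths-complement : ∀ {m n N s} (φ ψ : Γ m n → ℕ) → (∀ γ → φ γ + ψ γ ≡ N) → s ≤ N →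
  countPaths m n (λ γ → φ γ ≟ s) ≡ countPaths m n (λ γ → ψ γ ≟ N ∸ s)
countPaths-complement φ ψ φ+ψ≡N s≤N = countPaths-cong _ _
  (λ γ → complementary (φ+ψ≡N γ))
  (λ γ ψγ≡N∸s → trans (complementary (trans (+-comm (ψ γ) (φ γ)) (φ+ψ≡N γ)) ψγ≡N∸s) (m∸[m∸n]≡n s≤N))

nC0≡1 : ∀ n → n C 0 ≡ 1
nC0≡1 n = trans (nCk≡nC[n∸k] {0} {n} z≤n) (nCn≡1 n)

length-paths : ∀ m n → length (paths m n) ≡ (m + n) C n
length-paths zero    zero    = refl
length-paths (suc m) zero    =
  trans (length-map _▹right (paths m 0))
    (trans (length-paths m 0) (trans (nC0≡1 (m + 0)) (sym (nC0≡1 (suc m + 0)))))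
length-paths zero    (suc n) =
  trans (length-map _▹up (paths 0 n))
    (trans (length-paths 0 n) (trans (nCn≡1 n) (sym (nCn≡1 (suc n)))))
length-paths (suc m) (suc n) = begin
  length (map _▹right (paths m (suc n)) ++ map _▹up (paths (suc m) n))
    ≡⟨ length-++ (map _▹right (paths m (suc n))) ⟩
  length (map _▹right (paths m (suc n))) + length (map _▹up (paths (suc m) n))
    ≡⟨ cong₂ _+_ (trans (length-map _▹right (paths m (suc n))) (length-paths m (suc n)))
                 (trans (length-map _▹up (paths (suc m) n)) (length-paths (suc m) n)) ⟩
  (m + suc n) C suc n + (suc m + n) C n
    ≡⟨ +-comm ((m + suc n) C suc n) _ ⟩
  (suc m + n) C n + (m + suc n) C suc n
    ≡⟨ cong (λ t → t C n + (m + suc n) C suc n) (+-suc m n) ⟨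
  (m + suc n) C n + (m + suc n) C suc n
    ≡⟨ nCk+nC[k+1]≡[n+1]C[k+1] (m + suc n) n ⟩
  (suc m + suc n) C suc n ∎

-- Ballot numbers and the last visit to the diagonal

b-suc-zero : ∀ p → b (suc p) 0 ≡ b p 0
b-suc-zero p = trans (countPaths-right p strictlyBelow?)
  (countPaths-cong {p} {0} (strictlyBelow? ∘ _▹right) strictlyBelow?
    (λ _ → proj₁ ∘ ∷ʳ⁻) (λ _ ps → ∷ʳ⁺ ps (s≤s z≤n)))

b-zero : ∀ p → b p 0 ≡ 1
b-zero zero    = refl
b-zero (suc p) = trans (b-suc-zero p) (b-zero p)

b-diagonal : ∀ q → b (suc q) (suc q) ≡ 0
b-diagonal q = trans (countPaths-last q q strictlyBelow?) (cong₂ _+_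
  (countPaths-none {q} {suc q} (strictlyBelow? ∘ _▹right) (λ _ ps → <-irrefl refl (proj₂ (∷ʳ⁻ ps))))
  (countPaths-none {suc q} {q} (strictlyBelow? ∘ _▹up) (λ _ ps → <-irrefl refl (proj₂ (∷ʳ⁻ ps)))))

-- Since `q < p`, the final vertex is itself below the diagonal, so only the path before the last
-- step is restricted.
b-suc-suc : ∀ {p q} → q < p → b (suc p) (suc q) ≡ b p (suc q) + b (suc p) q
b-suc-suc {p} {q} q<p = trans (countPaths-last p q strictlyBelow?) (cong₂ _+_
  (countPaths-cong (strictlyBelow? ∘ _▹right) strictlyBelow?
    (λ _ → proj₁ ∘ ∷ʳ⁻) (λ _ ps → ∷ʳ⁺ ps (s≤s q<p)))
  (countPaths-cong (strictlyBelow? ∘ _▹up) strictlyBelow?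
    (λ _ → proj₁ ∘ ∷ʳ⁻) (λ _ ps → ∷ʳ⁺ ps (s≤s q<p))))

-- Think of `f p j` as counting paths to `(p , j)` under a condition that steps below the diagonal
-- do not affect. The recurrences determine `f` below the diagonal from its diagonal values, and the
-- sum satisfies them too. An abstract `f` serves both `countAbove` and, with coordinates exchanged,
-- `countBelow`.
last-visit : ∀ (f : ℕ → ℕ → ℕ) → (∀ p → f (suc p) 0 ≡ f p 0) →
             (∀ {p j} → j < p → f (suc p) (suc j) ≡ f p (suc j) + f (suc p) j) →
             ∀ {p j} → j ≤ p → f p j ≡ ∑[ 0 ⋯ j ] (λ i → f i i * b (p ∸ i) (j ∸ i))
last-visit f f₀ f₊ = go _ _
  where
  weight : ℕ → ℕ → ℕ → ℕ
  weight p j i = f i i * b (p ∸ i) (j ∸ i)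

  last-term : ∀ p j → weight p j j ≡ f j j
  last-term p j = begin
    f j j * b (p ∸ j) (j ∸ j)  ≡⟨ cong (λ t → f j j * b (p ∸ j) t) (n∸n≡0 j) ⟩
    f j j * b (p ∸ j) 0        ≡⟨ cong (f j j *_) (b-zero (p ∸ j)) ⟩
    f j j * 1                  ≡⟨ *-identityʳ (f j j) ⟩
    f j j                      ∎

  split : ∀ {p j i} → j < p → i ≤ j → weight (suc p) (suc j) i ≡ weight p (suc j) i + weight (suc p) j i
  split {p} {j} {i} j<p i≤j = begin
    f i i * b (suc p ∸ i) (suc j ∸ i)
      ≡⟨ cong₂ (λ s t → f i i * b s t) (+-∸-assoc 1 (≤-trans i≤j (<⇒≤ j<p))) (+-∸-assoc 1 i≤j) ⟩
    f i i * b (suc (p ∸ i)) (suc (j ∸ i))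
      ≡⟨ cong (f i i *_) (b-suc-suc (∸-monoˡ-< j<p i≤j)) ⟩
    f i i * (b (p ∸ i) (suc (j ∸ i)) + b (suc (p ∸ i)) (j ∸ i))
      ≡⟨ *-distribˡ-+ (f i i) _ _ ⟩
    f i i * b (p ∸ i) (suc (j ∸ i)) + f i i * b (suc (p ∸ i)) (j ∸ i)
      ≡⟨ cong₂ (λ s t → f i i * b (p ∸ i) s + f i i * b t (j ∸ i))
               (+-∸-assoc 1 i≤j) (+-∸-assoc 1 (≤-trans i≤j (<⇒≤ j<p))) ⟨
    weight p (suc j) i + weight (suc p) j i ∎

  on-diagonal : ∀ j → ∑[ 0 ⋯ j ] (weight j j) ≡ f j j
  on-diagonal zero    = trans (+-identityʳ _) (last-term 0 0)
  on-diagonal (suc j) = begin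
    ∑[ 0 ⋯ suc j ] (weight (suc j) (suc j))
      ≡⟨ ∑-last (weight (suc j) (suc j)) j ⟩
    ∑[ 0 ⋯ j ] (weight (suc j) (suc j)) + weight (suc j) (suc j) (suc j)
      -- Only `i = suc j` survives, since no nonempty ballot path ends on the diagonal.
      ≡⟨ cong₂ _+_ (∑-cong j vanish) (last-term (suc j) (suc j)) ⟩
    ∑[ 0 ⋯ j ] (λ _ → 0) + f (suc j) (suc j)
      ≡⟨ cong (_+ f (suc j) (suc j)) (∑-zero j) ⟩
    f (suc j) (suc j) ∎
    where
    vanish : ∀ i → i ≤ j → weight (suc j) (suc j) i ≡ 0
    vanish i i≤j = trans
      (cong (f i i *_) (trans (cong (λ t → b t t) (+-∸-assoc 1 i≤j)) (b-diagonal (j ∸ i))))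
      (*-zeroʳ (f i i))

  off-diagonal : ∀ {p j} → j < p →
                 f p (suc j) ≡ ∑[ 0 ⋯ suc j ] (weight p (suc j)) →
                 f (suc p) j ≡ ∑[ 0 ⋯ j ] (weight (suc p) j) →
                 f (suc p) (suc j) ≡ ∑[ 0 ⋯ suc j ] (weight (suc p) (suc j))
  off-diagonal {p} {j} j<p left down = begin
    f (suc p) (suc j)
      ≡⟨ f₊ j<p ⟩
    f p (suc j) + f (suc p) j
      ≡⟨ cong₂ _+_ (trans left (∑-last (weight p (suc j)) j)) down ⟩
    ∑[ 0 ⋯ j ] (weight p (suc j)) + weight p (suc j) (suc j) + ∑[ 0 ⋯ j ] (weight (suc p) j)
      ≡⟨ xy∙z≈xz∙y (∑[ 0 ⋯ j ] (weight p (suc j))) _ _ ⟩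
    ∑[ 0 ⋯ j ] (weight p (suc j)) + ∑[ 0 ⋯ j ] (weight (suc p) j) + weight p (suc j) (suc j)
      -- The term `i = suc j` is absent from the sum for `f (suc p) j`. Its ballot factor has the
      -- form `b _ 0`, which is 1, so it is the same for `p` and `suc p`.
      ≡⟨ cong₂ _+_
           (trans (∑-cong j (λ i i≤j → split j<p i≤j)) (∑-+ (weight p (suc j)) (weight (suc p) j) j))
           (trans (last-term (suc p) (suc j)) (sym (last-term p (suc j)))) ⟨
    ∑[ 0 ⋯ j ] (weight (suc p) (suc j)) + weight (suc p) (suc j) (suc j)
      ≡⟨ ∑-last (weight (suc p) (suc j)) j ⟨
    ∑[ 0 ⋯ suc j ] (weight (suc p) (suc j)) ∎

  go : ∀ p j → j ≤ p → f p j ≡ ∑[ 0 ⋯ j ] (weight p j)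
  go p       j       j≤p with m≤n⇒m<n∨m≡n j≤p
  go p       j       j≤p | inj₂ refl = sym (on-diagonal j)
  go (suc p) zero    _   | inj₁ _    =
    trans (f₀ p) (trans (go p zero z≤n) (cong (λ t → f 0 0 * t + 0) (sym (b-suc-zero p))))
  go (suc p) (suc j) _   | inj₁ (s≤s j<p) =
    off-diagonal j<p (go p (suc j) j<p) (go (suc p) j (≤-trans (<⇒≤ j<p) (n≤1+n p)))

-- Horizontal edges below and above the diagonal

below above : ∀ {m n} → Γ m n → ℕ
below γ = length (filter edgeBelow? (horizontalEdges γ))
above γ = length (filter (¬? ∘ edgeBelow?) (horizontalEdges γ))

length-horizontalEdges : ∀ {m n} (γ : Γ m n) → length (horizontalEdges γ) ≡ m
length-horizontalEdges origin        = refl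
length-horizontalEdges (_▹right {m} γ) =
  trans (length-++ (horizontalEdges γ)) (trans (+-comm _ 1) (cong suc (length-horizontalEdges γ)))
length-horizontalEdges (γ ▹up)       = length-horizontalEdges γ

below+above : ∀ {m n} (γ : Γ m n) → below γ + above γ ≡ m
below+above γ =
  trans (length-filter-complement edgeBelow? (horizontalEdges γ)) (length-horizontalEdges γ)

above+below : ∀ {m n} (γ : Γ m n) → above γ + below γ ≡ m
above+below γ = trans (+-comm (above γ) (below γ)) (below+above γ)

above≤ : ∀ {m n} (γ : Γ m n) → above γ ≤ m
above≤ γ = subst (above γ ≤_) (below+above γ) (m≤n+m (above γ) (below γ))

below≤ : ∀ {m n} (γ : Γ m n) → below γ ≤ m
below≤ γ = subst (below γ ≤_) (below+above γ) (m≤m+n (below γ) (above γ))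

module _ {m n} (γ : Γ m n) where

  below-right-< : m < n → below (γ ▹right) ≡ below γ
  below-right-< m<n = trans (length-filter-∷ʳ edgeBelow? (horizontalEdges γ) (m , n))
    (cong (_+ below γ) (I-false (edgeBelow? (m , n)) (<⇒≱ m<n)))

  below-right-≥ : n ≤ m → below (γ ▹right) ≡ suc (below γ)
  below-right-≥ n≤m = trans (length-filter-∷ʳ edgeBelow? (horizontalEdges γ) (m , n))
    (cong (_+ below γ) (I-true (edgeBelow? (m , n)) n≤m))

  above-right-< : m < n → above (γ ▹right) ≡ suc (above γ)
  above-right-< m<n = trans (length-filter-∷ʳ (¬? ∘ edgeBelow?) (horizontalEdges γ) (m , n))
    (cong (_+ above γ) (I-true (¬? (edgeBelow? (m , n))) (<⇒≱ m<n)))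

  above-right-≥ : n ≤ m → above (γ ▹right) ≡ above γ
  above-right-≥ n≤m = trans (length-filter-∷ʳ (¬? ∘ edgeBelow?) (horizontalEdges γ) (m , n))
    (cong (_+ above γ) (I-false (¬? (edgeBelow? (m , n))) (λ n≰m → n≰m n≤m)))

countAbove countBelow : (r m n : ℕ) → ℕ
countAbove r m n = countPaths m n (λ γ → above γ ≟ r)
countBelow s m n = countPaths m n (λ γ → below γ ≟ s)

countAbove-suc-zero : ∀ r p → countAbove r (suc p) 0 ≡ countAbove r p 0
countAbove-suc-zero r p = trans (countPaths-right p _)
  (countPaths-≗ {p} {0} _ above r (λ γ → above-right-≥ γ z≤n))

countAbove-suc-suc : ∀ r {p j} → j < p →
  countAbove r (suc p) (suc j) ≡ countAbove r p (suc j) + countAbove r (suc p) j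
countAbove-suc-suc r {p} {j} j<p = trans (countPaths-last p j _)
  (cong (_+ countAbove r (suc p) j) (countPaths-≗ _ above r (λ γ → above-right-≥ γ j<p)))

countAbove-diagonal : ∀ r j → countAbove r (suc j) (suc j)
  ≡ countPaths j (suc j) (λ γ → suc (above γ) ≟ r) + countAbove r (suc j) j
countAbove-diagonal r j = trans (countPaths-last j j _) (cong (_+ countAbove r (suc j) j)
  (countPaths-≗ {j} {suc j} _ (suc ∘ above) r (λ γ → above-right-< γ ≤-refl)))

countBelow-zero-suc : ∀ s p → countBelow s 0 (suc p) ≡ countBelow s 0 p
countBelow-zero-suc s p = countPaths-up p _

-- The summands are exchanged so that, with coordinates swapped, this is the recurrence `last-visit`
-- expects.
countBelow-suc-suc : ∀ s {p j} → j < p →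
  countBelow s (suc j) (suc p) ≡ countBelow s (suc j) p + countBelow s j (suc p)
countBelow-suc-suc s {p} {j} j<p = begin
  countBelow s (suc j) (suc p)
    ≡⟨ countPaths-last j p _ ⟩
  countPaths j (suc p) (λ γ → below (γ ▹right) ≟ s) + countBelow s (suc j) p
    ≡⟨ cong (_+ countBelow s (suc j) p)
         (countPaths-≗ _ below s (λ γ → below-right-< γ (≤-trans j<p (n≤1+n p)))) ⟩
  countBelow s j (suc p) + countBelow s (suc j) p
    ≡⟨ +-comm (countBelow s j (suc p)) _ ⟩
  countBelow s (suc j) p + countBelow s j (suc p) ∎

-- Prepending a right step turns a weakly subdiagonal path into a strictly
-- subdiagonal one; here this appears as equality of the two recurrences.
countAbove-zero≡b : ∀ p q → q ≤ p → countAbove 0 p q ≡ b (suc p) q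
countAbove-zero≡b zero    zero    _ = refl
countAbove-zero≡b (suc p) zero    _ =
  trans (countAbove-suc-zero 0 p) (trans (countAbove-zero≡b p 0 z≤n) (sym (b-suc-zero (suc p))))
countAbove-zero≡b (suc p) (suc q) (s≤s q≤p) with m≤n⇒m<n∨m≡n q≤p
... | inj₁ q<p  = trans (countAbove-suc-suc 0 q<p) (trans
  (cong₂ _+_ (countAbove-zero≡b p (suc q) q<p)
             (countAbove-zero≡b (suc p) q (≤-trans q≤p (n≤1+n p))))
  (sym (b-suc-suc (s≤s q≤p))))
-- A final right edge onto the diagonal lies above it and is excluded; its counterpart among ballot
-- paths would touch the diagonal, whence `b-diagonal`.
... | inj₂ refl = trans (countAbove-diagonal 0 p) (trans
  (cong₂ _+_ (trans (countPaths-none {p} {suc p} _ (λ _ ())) (sym (b-diagonal p)))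
             (countAbove-zero≡b (suc p) p (n≤1+n p)))
  (sym (b-suc-suc {suc p} {p} ≤-refl)))

-- The Chung–Feller theorem

-- The reflection of `i` to `j ∸ i` preserves `w` and turns the condition `suc j ∸ r ≤ i` into
-- `i < r`, the complement of `r ≤ i`. This is what makes the Chung-Feller count independent of `r`.
∑-split : ∀ (w : ℕ → ℕ) {j r} → (∀ i → i ≤ j → w (j ∸ i) ≡ w i) → r ≤ suc j →
  ∑[ 0 ⋯ j ] (λ i → I (suc j ∸ r ≤? i) * w i) + ∑[ 0 ⋯ j ] (λ i → I (r ≤? i) * w i) ≡ ∑[ 0 ⋯ j ] w
∑-split w {j} {r} w-sym r≤1+j = begin
  ∑[ 0 ⋯ j ] (λ i → I (suc j ∸ r ≤? i) * w i) + ∑[ 0 ⋯ j ] upper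
    ≡⟨ cong (_+ ∑[ 0 ⋯ j ] upper) (trans (∑-reverse (λ i → I (suc j ∸ r ≤? i) * w i) j) (∑-cong j reflect)) ⟩
  ∑[ 0 ⋯ j ] lower + ∑[ 0 ⋯ j ] upper
    ≡⟨ ∑-+ lower upper j ⟨
  ∑[ 0 ⋯ j ] (λ i → lower i + upper i)
    ≡⟨ ∑-cong j (λ i _ → recombine i) ⟩
  ∑[ 0 ⋯ j ] w ∎
  where
  lower upper : ℕ → ℕ
  lower i = I (i <? r) * w i
  upper i = I (r ≤? i) * w i

  reflect : ∀ i → i ≤ j → I (suc j ∸ r ≤? j ∸ i) * w (j ∸ i) ≡ lower i
  reflect i i≤j = cong₂ _*_
    (I-cong (suc j ∸ r ≤? j ∸ i) (i <? r) (∸-cancelʳ-≤ (s≤s i≤j)) (∸-monoʳ-≤ (suc j)))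
    (w-sym i i≤j)

  recombine : ∀ i → lower i + upper i ≡ w i
  recombine i with ≤-<-connex r i
  ... | inj₁ r≤i = cong₂ _+_ (I-false-* (i <? r) (≤⇒≯ r≤i) (w i)) (I-true-* (r ≤? i) r≤i (w i))
  ... | inj₂ i<r = trans
    (cong₂ _+_ (I-true-* (i <? r) i<r (w i)) (I-false-* (r ≤? i) (<⇒≱ i<r) (w i)))
    (+-identityʳ (w i))

-- The common value is stated as a ballot number; its closed form only follows once all classes are
-- known to be equal.
Equidistributed : ℕ → Set
Equidistributed j = ∀ r → r ≤ j → countAbove r j j ≡ b (suc j) j

-- For `r > j` both sides are 0, as a path to `(j , j)` has only `j` horizontal edges. Such `r` do
-- occur: a last visit may be at an `i` smaller than the prescribed number of edges.
countAbove-equidistributed : ∀ {j} → Equidistributed j →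
                             ∀ r → countAbove r j j ≡ I (r ≤? j) * b (suc j) j
countAbove-equidistributed {j} eq r with r ≤? j
... | yes r≤j = trans (eq r r≤j) (sym (I-true-* (r ≤? j) r≤j _))
... | no  r≰j = trans
  (countPaths-none _ (λ γ above≡r → r≰j (subst (_≤ j) above≡r (above≤ γ))))
  (sym (I-false-* (r ≤? j) r≰j _))

countBelow-equidistributed : ∀ {j} → Equidistributed j →
                             ∀ s → countBelow s j j ≡ I (s ≤? j) * b (suc j) j
countBelow-equidistributed {j} eq s with s ≤? j
... | yes s≤j = trans (countPaths-complement below above below+above s≤j)
                      (trans (eq (j ∸ s) (m∸n≤m j s)) (sym (I-true-* (s ≤? j) s≤j _)))
... | no  s≰j = trans
  (countPaths-none _ (λ γ below≡s → s≰j (subst (_≤ j) below≡s (below≤ γ))))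
  (sym (I-false-* (s ≤? j) s≰j _))

-- Strong induction, because the previous visit to the diagonal can be any `(i , i)` with `i ≤ j`.
-- The value common to all `r` is identified at `r = 0` by `countAbove-zero≡b`.
chung-feller : ∀ j → Equidistributed j
chung-feller = <-rec Equidistributed step
  where
  step : ∀ j → (∀ {i} → i < j → Equidistributed i) → Equidistributed j
  step zero    _   zero _ = refl
  step (suc j) rec r r≤1+j = begin
    countAbove r (suc j) (suc j)  ≡⟨ independent r≤1+j ⟩
    ∑[ 0 ⋯ j ] w                  ≡⟨ independent z≤n ⟨
    countAbove 0 (suc j) (suc j)  ≡⟨ countAbove-zero≡b (suc j) (suc j) ≤-refl ⟩
    b (suc (suc j)) (suc j)       ∎
    where
    -- The Catalan convolution: the size `b (suc i) i` of a class of paths to `(i , i)`, times the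
    -- number of ballot paths from there to a neighbour of the endpoint.
    w : ℕ → ℕ
    w i = b (suc i) i * b (suc (j ∸ i)) (j ∸ i)

    w-sym : ∀ i → i ≤ j → w (j ∸ i) ≡ w i
    w-sym i i≤j = trans (cong (λ t → b (suc (j ∸ i)) (j ∸ i) * b (suc t) t) (m∸[m∸n]≡n i≤j))
                        (*-comm (b (suc (j ∸ i)) (j ∸ i)) _)

    term : ∀ {c d : ℕ} i → i ≤ j → c ≡ d * b (suc i) i →
           c * b (suc j ∸ i) (j ∸ i) ≡ d * w i
    term {c} {d} i i≤j c≡ = trans
      (cong₂ (λ s t → s * b t (j ∸ i)) c≡ (+-∸-assoc 1 i≤j)) (*-assoc d _ _)

    independent : ∀ {r} → r ≤ suc j → countAbove r (suc j) (suc j) ≡ ∑[ 0 ⋯ j ] w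
    independent {r} r≤1+j = begin
      countAbove r (suc j) (suc j)
        ≡⟨ countAbove-diagonal r j ⟩
      countPaths j (suc j) (λ γ → suc (above γ) ≟ r) + countAbove r (suc j) j
        -- The final edge is above the diagonal, so `suc j ∸ r` of the other `j` edges are below.
        -- For `r = 0` that is one too many, and the count is rightly 0.
        ≡⟨ cong (_+ countAbove r (suc j) j)
             (countPaths-complement (suc ∘ above) below (cong suc ∘ above+below) r≤1+j) ⟩
      countBelow (suc j ∸ r) j (suc j) + countAbove r (suc j) j
        ≡⟨ cong₂ _+_
             (last-visit (λ p i → countBelow (suc j ∸ r) i p)
               (countBelow-zero-suc (suc j ∸ r)) (countBelow-suc-suc (suc j ∸ r)) (n≤1+n j))
             (last-visit (countAbove r) (countAbove-suc-zero r) (countAbove-suc-suc r) (n≤1+n j)) ⟩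
      ∑[ 0 ⋯ j ] (λ i → countBelow (suc j ∸ r) i i * b (suc j ∸ i) (j ∸ i))
        + ∑[ 0 ⋯ j ] (λ i → countAbove r i i * b (suc j ∸ i) (j ∸ i))
        ≡⟨ cong₂ _+_
             (∑-cong j (λ i i≤j → term {d = I (suc j ∸ r ≤? i)} i i≤j
               (countBelow-equidistributed (rec (s≤s i≤j)) (suc j ∸ r))))
             (∑-cong j (λ i i≤j → term {d = I (r ≤? i)} i i≤j
               (countAbove-equidistributed (rec (s≤s i≤j)) r))) ⟩
      ∑[ 0 ⋯ j ] (λ i → I (suc j ∸ r ≤? i) * w i) + ∑[ 0 ⋯ j ] (λ i → I (r ≤? i) * w i)
        ≡⟨ ∑-split w w-sym r≤1+j ⟩
      ∑[ 0 ⋯ j ] w ∎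

-- All `(2 * j) C j` paths to `(j , j)` fall into `suc j` classes of size `b (suc j) j`. The total
-- is thus an exact multiple of `suc j`, and the division in `catalan` returns the class size.
b≡catalan : ∀ j → b (suc j) j ≡ catalan j
b≡catalan j = begin
  b (suc j) j                      ≡⟨ m*n/n≡m (b (suc j) j) (suc j) ⟨
  (b (suc j) j * suc j) / suc j    ≡⟨ /-congˡ total ⟩
  ((2 * j) C j) / suc j            ∎
  where
  total : b (suc j) j * suc j ≡ (2 * j) C j
  total = begin
    b (suc j) j * suc j                   ≡⟨ *-comm (b (suc j) j) (suc j) ⟩
    suc j * b (suc j) j                   ≡⟨ ∑-const (b (suc j) j) j ⟨
    ∑[ 0 ⋯ j ] (λ _ → b (suc j) j)        ≡⟨ ∑-cong j (chung-feller j) ⟨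
    ∑[ 0 ⋯ j ] (λ r → countAbove r j j)   ≡⟨ ∑-fibres above j above≤ (paths j j) ⟩
    length (paths j j)                    ≡⟨ length-paths j j ⟩
    (j + j) C j                           ≡⟨ cong (λ t → (j + t) C j) (+-identityʳ j) ⟨
    (2 * j) C j                           ∎

-- The inner sum of the theorem, for `p = k ∸ 1`. It starts at `r` because a path to `(i , i)` can
-- have `r` horizontal edges on a given side only if `r ≤ i`.
lastVisitSum : (r p j : ℕ) → ℕ
lastVisitSum r p j = ∑[ r ⋯ j ] (λ i → catalan i * b (p ∸ i) (j ∸ i))

last-visit-catalan : ∀ (f : ℕ → ℕ → ℕ) r → (∀ p → f (suc p) 0 ≡ f p 0) →
  (∀ {p j} → j < p → f (suc p) (suc j) ≡ f p (suc j) + f (suc p) j) →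
  (∀ i → f i i ≡ I (r ≤? i) * b (suc i) i) →
  ∀ {p j} → j ≤ p → f p j ≡ lastVisitSum r p j
last-visit-catalan f r f₀ f₊ diag {p} {j} j≤p = begin
  f p j
    ≡⟨ last-visit f f₀ f₊ j≤p ⟩
  ∑[ 0 ⋯ j ] (λ i → f i i * b (p ∸ i) (j ∸ i))
    ≡⟨ ∑-cong j (λ i _ → term i) ⟩
  ∑[ 0 ⋯ j ] (λ i → I (r ≤? i) * (catalan i * b (p ∸ i) (j ∸ i)))
    ≡⟨ ∑-I r (λ i → catalan i * b (p ∸ i) (j ∸ i)) j ⟩
  lastVisitSum r p j ∎
  where
  term : ∀ i → f i i * b (p ∸ i) (j ∸ i) ≡ I (r ≤? i) * (catalan i * b (p ∸ i) (j ∸ i))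
  term i = trans
    (cong (_* b (p ∸ i) (j ∸ i)) (trans (diag i) (cong (I (r ≤? i) *_) (b≡catalan i))))
    (*-assoc (I (r ≤? i)) (catalan i) _)

countAbove≡lastVisitSum : ∀ r {p j} → j ≤ p → countAbove r p j ≡ lastVisitSum r p j
countAbove≡lastVisitSum r = last-visit-catalan (countAbove r) r
  (countAbove-suc-zero r) (countAbove-suc-suc r)
  (λ i → countAbove-equidistributed (chung-feller i) r)

countBelow≡lastVisitSum : ∀ s {p j} → j ≤ p → countBelow s j p ≡ lastVisitSum s p j
countBelow≡lastVisitSum s = last-visit-catalan (λ p j → countBelow s j p) s
  (countBelow-zero-suc s) (countBelow-suc-suc s)
  (λ i → countBelow-equidistributed (chung-feller i) s)

-- Both sides count the same class of paths to `(j , j)`. This supplies the case `j = k ∸ 1`, where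
-- the theorem has a single Catalan number.
lastVisitSum-diagonal : ∀ r j → lastVisitSum r j j ≡ I (r ≤? j) * catalan j
lastVisitSum-diagonal r j = begin
  lastVisitSum r j j           ≡⟨ countAbove≡lastVisitSum r ≤-refl ⟨
  countAbove r j j             ≡⟨ countAbove-equidistributed (chung-feller j) r ⟩
  I (r ≤? j) * b (suc j) j     ≡⟨ cong (I (r ≤? j) *_) (b≡catalan j) ⟩
  I (r ≤? j) * catalan j       ∎

-- Leaving the square [0 , k]²

continuationsFrom : (K : ℕ) (σ : ℕ → ℕ) (a t j : ℕ) → ℕ
continuationsFrom K σ a t j = σ j * ((a + (t + (K ∸ j))) C a)

-- With σ j paths entering at (0 , j), this counts their continuations to
-- (a , K + t).
continuations : (K : ℕ) (σ : ℕ → ℕ) (a t : ℕ) → ℕ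
continuations K σ a t = ∑[ 0 ⋯ K ] (continuationsFrom K σ a t)

continuations-cong : ∀ K {σ τ} a t → (∀ j → j ≤ K → σ j ≡ τ j) →
                     continuations K σ a t ≡ continuations K τ a t
continuations-cong K a t σ≗τ =
  ∑-cong K (λ j j≤K → cong (_* ((a + (t + (K ∸ j))) C a)) (σ≗τ j j≤K))

continuations-zero : ∀ K σ t t′ → continuations K σ 0 t ≡ continuations K σ 0 t′
continuations-zero K σ t t′ = ∑-cong K (λ j _ → cong (σ j *_)
  (trans (nC0≡1 (t + (K ∸ j))) (sym (nC0≡1 (t′ + (K ∸ j))))))

continuations-pascal : ∀ K σ a t → continuations K σ (suc a) (suc t)
  ≡ continuations K σ a (suc t) + continuations K σ (suc a) t
continuations-pascal K σ a t = trans (∑-cong K (λ j _ → pascal j))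
  (∑-+ (continuationsFrom K σ a (suc t)) (continuationsFrom K σ (suc a) t) K)
  where
  pascal : ∀ j → continuationsFrom K σ (suc a) (suc t) j
                 ≡ continuationsFrom K σ a (suc t) j + continuationsFrom K σ (suc a) t j
  pascal j = begin
    σ j * (suc N C suc a)              ≡⟨ cong (σ j *_) (nCk+nC[k+1]≡[n+1]C[k+1] N a) ⟨
    σ j * (N C a + N C suc a)          ≡⟨ *-distribˡ-+ (σ j) (N C a) _ ⟩
    σ j * (N C a) + σ j * (N C suc a)
      ≡⟨ cong (λ t → σ j * (N C a) + σ j * (t C suc a)) (+-suc a (t + (K ∸ j))) ⟩
    σ j * (N C a) + σ j * ((suc a + (t + (K ∸ j))) C suc a) ∎
    where N = a + (suc t + (K ∸ j))

-- Paths entering at height at most `K` have one more level to climb, hence `t = 1`; those entering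
-- at `suc K` can only go right, in one way.
continuations-last : ∀ K σ a →
  continuations (suc K) σ a 0 ≡ continuations K σ a 1 + σ (suc K)
continuations-last K σ a = trans (∑-last (continuationsFrom (suc K) σ a 0) K) (cong₂ _+_
  (∑-cong K (λ j j≤K → cong (λ t → σ j * ((a + t) C a)) (+-∸-assoc 1 j≤K)))
  (begin
    σ (suc K) * ((a + (K ∸ K)) C a)  ≡⟨ cong (λ t → σ (suc K) * ((a + t) C a)) (n∸n≡0 K) ⟩
    σ (suc K) * ((a + 0) C a)        ≡⟨ cong (λ t → σ (suc K) * (t C a)) (+-identityʳ a) ⟩
    σ (suc K) * (a C a)              ≡⟨ cong (σ (suc K) *_) (nCn≡1 a) ⟩
    σ (suc K) * 1                    ≡⟨ *-identityʳ _ ⟩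
    σ (suc K)                        ∎))

-- The hypotheses are Pascal's recurrence with a source: `σ j` new paths enter column 0 at height
-- `j`. Its solution is unique.
continuations-unique : ∀ (g : ℕ → ℕ → ℕ) σ → g 0 0 ≡ σ 0 → (∀ a → g (suc a) 0 ≡ g a 0) →
  (∀ j → g 0 (suc j) ≡ g 0 j + σ (suc j)) →
  (∀ a j → g (suc a) (suc j) ≡ g a (suc j) + g (suc a) j) →
  ∀ a j → g a j ≡ continuations j σ a 0
continuations-unique g σ g₀₀ g₊₀ g₀₊ g₊₊ = go
  where
  go : ∀ a j → g a j ≡ continuations j σ a 0
  go zero    zero    = trans g₀₀ (sym (trans (+-identityʳ _) (*-identityʳ (σ 0))))
  go (suc a) zero    = trans (g₊₀ a) (trans (go a 0) (cong (λ t → σ 0 * t + 0)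
    (trans (both a) (sym (both (suc a))))))
    where
    both : ∀ a → (a + 0) C a ≡ 1
    both a = trans (cong (_C a) (+-identityʳ a)) (nCn≡1 a)
  go zero    (suc j) = begin
    g 0 (suc j)                            ≡⟨ g₀₊ j ⟩
    g 0 j + σ (suc j)                      ≡⟨ cong (_+ σ (suc j)) (go 0 j) ⟩
    continuations j σ 0 0 + σ (suc j)      ≡⟨ cong (_+ σ (suc j)) (continuations-zero j σ 0 1) ⟩
    continuations j σ 0 1 + σ (suc j)      ≡⟨ continuations-last j σ 0 ⟨
    continuations (suc j) σ 0 0            ∎
  go (suc a) (suc j) = begin
    g (suc a) (suc j)
      ≡⟨ g₊₊ a j ⟩
    g a (suc j) + g (suc a) j
      ≡⟨ cong₂ _+_ (trans (go a (suc j)) (continuations-last j σ a)) (go (suc a) j) ⟩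
    continuations j σ a 1 + σ (suc j) + continuations j σ (suc a) 0
      ≡⟨ xy∙z≈xz∙y (continuations j σ a 1) _ _ ⟩
    continuations j σ a 1 + continuations j σ (suc a) 0 + σ (suc j)
      ≡⟨ cong (_+ σ (suc j)) (continuations-pascal j σ a 0) ⟨
    continuations j σ (suc a) 1 + σ (suc j)
      ≡⟨ continuations-last j σ (suc a) ⟨
    continuations (suc j) σ (suc a) 0 ∎

HE≡below : ∀ {m n k} (γ : Γ m n) → m ≤ k → HE k γ ≡ below γ
HE≡below {k = k} γ m≤k = cong (length ∘ filter edgeBelow?)
  (take-all k (horizontalEdges γ) (subst (_≤ k) (sym (length-horizontalEdges γ)) m≤k))

HE-right-≥ : ∀ {m n k} (γ : Γ m n) → k ≤ m → HE k (γ ▹right) ≡ HE k γ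
HE-right-≥ {k = k} γ k≤m = cong (length ∘ filter edgeBelow?)
  (take-∷ʳ k (horizontalEdges γ) _ (subst (k ≤_) (sym (length-horizontalEdges γ)) k≤m))

-- Either the first `k` horizontal edges are already present, or the new edge starts at `m < k ≤ n`
-- and lies above the diagonal.
HE-right : ∀ {m n k} (γ : Γ m n) → k ≤ m ⊎ k ≤ n → HE k (γ ▹right) ≡ HE k γ
HE-right γ (inj₁ k≤m) = HE-right-≥ γ k≤m
HE-right {m} {n} {k} γ (inj₂ k≤n) with k ≤? m
... | yes k≤m = HE-right-≥ γ k≤m
... | no  k≰m = begin
  HE k (γ ▹right)  ≡⟨ HE≡below (γ ▹right) m<k ⟩
  below (γ ▹right) ≡⟨ below-right-< γ (≤-trans m<k k≤n) ⟩
  below γ          ≡⟨ HE≡below γ (<⇒≤ m<k) ⟨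
  HE k γ           ∎
  where m<k = ≰⇒> k≰m

module _ (K l : ℕ) where

  private
    k = suc K

    f : ℕ → ℕ → ℕ
    f m n = # m n k l

    -- An exit to the right is made by the `k`th horizontal edge, which `HE k` must still take into
    -- account. An exit upwards, in `x`, adds no horizontal edge.
    y : ℕ → ℕ
    y j = countPaths K j (λ γ → HE k (γ ▹right) ≟ l)

    x : ℕ → ℕ
    x j = f j K

    f-suc-suc : ∀ m n → k ≤ m ⊎ k ≤ suc n → f (suc m) (suc n) ≡ f m (suc n) + f (suc m) n
    f-suc-suc m n out = trans (countPaths-last m n _)
      (cong (_+ f (suc m) n) (countPaths-≗ _ (HE k) l (λ γ → HE-right γ out)))

    f-suc-zero : ∀ m → k ≤ m → f (suc m) 0 ≡ f m 0
    f-suc-zero m k≤m = trans (countPaths-right m _)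
      (countPaths-≗ _ (HE k) l (λ γ → HE-right γ (inj₁ k≤m)))

    right-of-square : ∀ p j → f (p + k) j ≡ continuations j y p 0
    right-of-square = continuations-unique (λ p j → f (p + k) j) y
      (countPaths-right K _)
      (λ p → f-suc-zero (p + k) (m≤n+m k p))
      (λ j → trans (countPaths-last K j _) (+-comm (y (suc j)) _))
      (λ p j → f-suc-suc (p + k) j (inj₁ (m≤n+m k p)))

    -- Coordinates are exchanged here: row `k` plays the part of column 0, entered by up steps from
    -- `(j , K)`.
    above-square : ∀ q j → f j (q + k) ≡ continuations j x q 0
    above-square = continuations-unique (λ q j → f j (q + k)) x
      (countPaths-up K _)
      (λ q → countPaths-up (q + k) _)
      (λ j → f-suc-suc j K (inj₂ ≤-refl))
      (λ q j → trans (f-suc-suc j (q + k) (inj₂ (m≤n+m k (suc q)))) (+-comm (f j (suc q + k)) _))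

    -- Both summands obey Pascal's recurrence in `p` and `q`. Predecessors in column `K` or row `K`
    -- are counted by `above-square` and `right-of-square`. The endpoint lies `suc p` and `suc q`
    -- beyond `K`.
    exit : ∀ p q → f (p + k) (q + k) ≡ continuations K x q (suc p) + continuations K y p (suc q)
    exit zero    zero    = trans (f-suc-suc K K (inj₂ ≤-refl)) (cong₂ _+_
      (trans (above-square 0 K) (continuations-zero K x 0 1))
      (trans (right-of-square 0 K) (continuations-zero K y 0 1)))
    exit (suc p) zero    = begin
      f (suc p + k) k
        ≡⟨ f-suc-suc (p + k) K (inj₂ ≤-refl) ⟩
      f (p + k) k + f (suc p + k) K
        ≡⟨ cong₂ _+_ (exit p 0) (right-of-square (suc p) K) ⟩
      continuations K x 0 (suc p) + continuations K y p 1 + continuations K y (suc p) 0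
        ≡⟨ +-assoc (continuations K x 0 (suc p)) _ _ ⟩
      continuations K x 0 (suc p) + (continuations K y p 1 + continuations K y (suc p) 0)
        ≡⟨ cong₂ _+_ (continuations-zero K x (suc p) (suc (suc p)))
                     (sym (continuations-pascal K y p 0)) ⟩
      continuations K x 0 (suc (suc p)) + continuations K y (suc p) 1 ∎
    exit zero    (suc q) = begin
      f k (suc q + k)
        ≡⟨ f-suc-suc K (q + k) (inj₂ (m≤n+m k (suc q))) ⟩
      f K (suc q + k) + f k (q + k)
        ≡⟨ cong₂ _+_ (above-square (suc q) K) (exit 0 q) ⟩
      continuations K x (suc q) 0 + (continuations K x q 1 + continuations K y 0 (suc q))
        ≡⟨ +-assoc (continuations K x (suc q) 0) _ _ ⟨
      continuations K x (suc q) 0 + continuations K x q 1 + continuations K y 0 (suc q)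
        ≡⟨ cong₂ _+_ (trans (+-comm (continuations K x (suc q) 0) _)
                            (sym (continuations-pascal K x q 0)))
                     (continuations-zero K y (suc q) (suc (suc q))) ⟩
      continuations K x (suc q) 1 + continuations K y 0 (suc (suc q)) ∎
    exit (suc p) (suc q) = begin
      f (suc p + k) (suc q + k)
        ≡⟨ f-suc-suc (p + k) (q + k) (inj₁ (m≤n+m k p)) ⟩
      f (p + k) (suc q + k) + f (suc p + k) (q + k)
        ≡⟨ cong₂ _+_ (exit p (suc q)) (exit (suc p) q) ⟩
      continuations K x (suc q) (suc p) + continuations K y p (suc (suc q))
        + (continuations K x q (suc (suc p)) + continuations K y (suc p) (suc q))
        ≡⟨ +-interchange (continuations K x (suc q) (suc p)) _ _ _ ⟩
      continuations K x (suc q) (suc p) + continuations K x q (suc (suc p))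
        + (continuations K y p (suc (suc q)) + continuations K y (suc p) (suc q))
        ≡⟨ cong₂ _+_ (trans (+-comm (continuations K x (suc q) (suc p)) _)
                            (sym (continuations-pascal K x q (suc p))))
                     (sym (continuations-pascal K y p (suc q))) ⟩
      continuations K x (suc q) (suc (suc p)) + continuations K y (suc p) (suc (suc q)) ∎

    x≡lastVisitSum : ∀ j → j ≤ K → x j ≡ lastVisitSum l K j
    x≡lastVisitSum j j≤K = trans
      (countPaths-≗ (HE k) below l (λ γ → HE≡below γ (≤-trans j≤K (n≤1+n K))))
      (countBelow≡lastVisitSum l j≤K)

    y≡lastVisitSum : l ≤ k → ∀ j → j ≤ K → y j ≡ lastVisitSum (k ∸ l) K j
    y≡lastVisitSum l≤k j j≤K = begin
      y j
        ≡⟨ countPaths-≗ _ (suc ∘ below) l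
             (λ γ → trans (HE≡below (γ ▹right) ≤-refl) (below-right-≥ γ j≤K)) ⟩
      -- The path ends on or below the diagonal, so its edges above are the ones that steps after
      -- the last visit leave unchanged. There are `k ∸ l` of them, the exit edge being below.
      countPaths K j (λ γ → suc (below γ) ≟ l)
        ≡⟨ countPaths-complement (suc ∘ below) above (cong suc ∘ below+above) l≤k ⟩
      countAbove (k ∸ l) K j
        ≡⟨ countAbove≡lastVisitSum (k ∸ l) j≤K ⟩
      lastVisitSum (k ∸ l) K j ∎

  #-by-exit : l ≤ k → ∀ p q → # (p + k) (q + k) k l
    ≡ continuations K (lastVisitSum l K) q (suc p)
      + continuations K (lastVisitSum (k ∸ l) K) p (suc q)
  #-by-exit l≤k p q = trans (exit p q) (cong₂ _+_
    (continuations-cong K q (suc p) x≡lastVisitSum)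
    (continuations-cong K p (suc q) (y≡lastVisitSum l≤k)))

-- Matching the binomial coefficients and indicators of the statement

∸-exit : ∀ {K j} p q → j ≤ K → p + suc K + (q + suc K) ∸ suc K ∸ j ≡ q + (suc p + (K ∸ j))
∸-exit {K} {j} p q j≤K = begin
  p + suc K + (q + suc K) ∸ suc K ∸ j
    -- With `K` written as `d + j`, each truncated subtraction cancels a summand.
    ≡⟨ cong (λ t → p + suc t + (q + suc K) ∸ suc K ∸ j) (m∸n+n≡m j≤K) ⟨
  p + suc (d + j) + (q + suc K) ∸ suc K ∸ j
    ≡⟨ cong (λ t → t ∸ suc K ∸ j) (shuffle p q d j (suc K)) ⟩
  q + (suc p + d) + j + suc K ∸ suc K ∸ j
    ≡⟨ cong (_∸ j) (m+n∸n≡m (q + (suc p + d) + j) (suc K)) ⟩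
  q + (suc p + d) + j ∸ j
    ≡⟨ m+n∸n≡m (q + (suc p + d)) j ⟩
  q + (suc p + d) ∎
  where
  d = K ∸ j
  shuffle : ∀ p q d j k → p + suc (d + j) + (q + k) ≡ q + (suc p + d) + j + k
  shuffle = solve-∀

∸-exit-corner : ∀ p q k → p + k + (q + k) ∸ 2 * k + 1 ≡ q + (suc p + 0)
∸-exit-corner p q k = begin
  p + k + (q + k) ∸ 2 * k + 1  ≡⟨ cong (λ t → t ∸ 2 * k + 1) (shuffle p q k) ⟩
  p + q + 2 * k ∸ 2 * k + 1    ≡⟨ cong (_+ 1) (m+n∸n≡m (p + q) (2 * k)) ⟩
  p + q + 1                    ≡⟨ shuffle′ p q ⟩
  q + (suc p + 0)              ∎
  where
  shuffle : ∀ p q k → p + k + (q + k) ≡ p + q + 2 * k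
  shuffle = solve-∀
  shuffle′ : ∀ p q → p + q + 1 ≡ q + (suc p + 0)
  shuffle′ = solve-∀

-- For `j < K` the indicator agrees with the inner sum, which is empty when `j < l`. For `j = K` the
-- stated value is a bare Catalan number, and the indicator is the one in `lastVisitSum-diagonal`.
I*B⟨j,k⟩ : ∀ {K j} p q l → j ≤ K →
  I (l ≤? j) * ∣B⟨j,k⟩∣ (p + suc K) (q + suc K) (suc K) j l
    ≡ lastVisitSum l K j * ((q + (suc p + (K ∸ j))) C q)
I*B⟨j,k⟩ {K} {j} p q l j≤K with m≤n⇒m<n∨m≡n j≤K
... | inj₁ j<K rewrite dec-true (j <? K) j<K | ∸-exit p q j≤K | m+n∸n≡m q (suc K) = begin
  I (l ≤? j) * ((N C q) * lastVisitSum l K j)    ≡⟨ cong (I (l ≤? j) *_) (*-comm (N C q) _) ⟩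
  I (l ≤? j) * (lastVisitSum l K j * (N C q))  ≡⟨ redundant ⟩
  lastVisitSum l K j * (N C q)                 ∎
  where
  N = q + (suc p + (K ∸ j))
  redundant : I (l ≤? j) * (lastVisitSum l K j * (N C q)) ≡ lastVisitSum l K j * (N C q)
  redundant with l ≤? j
  ... | yes l≤j = I-true-* (l ≤? j) l≤j _
  ... | no  l≰j = trans (I-false-* (l ≤? j) l≰j _)
    (sym (cong (_* (N C q)) (∑-empty {l} (λ i → catalan i * b (K ∸ i) (j ∸ i)) (≰⇒> l≰j))))
... | inj₂ refl rewrite dec-false (j <? j) (<-irrefl refl) | ∸-exit-corner p q (suc j)
                      | m+n∸n≡m q (suc j) | n∸n≡0 j = begin
  I (l ≤? j) * ((N C q) * catalan j)      ≡⟨ cong (I (l ≤? j) *_) (*-comm (N C q) _) ⟩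
  I (l ≤? j) * (catalan j * (N C q))    ≡⟨ *-assoc (I (l ≤? j)) (catalan j) _ ⟨
  I (l ≤? j) * catalan j * (N C q)      ≡⟨ cong (_* (N C q)) (lastVisitSum-diagonal l j) ⟨
  lastVisitSum l j j * (N C q)          ∎
  where N = q + (suc p + 0)

-- Exchanging `m` with `n` and `l` with `k ∸ l` lets `I*B⟨j,k⟩` handle both sums of the theorem.
B⟨k,j⟩≡B⟨j,k⟩ : ∀ m n k j l → ∣B⟨k,j⟩∣ m n k j l ≡ ∣B⟨j,k⟩∣ n m k j (k ∸ l)
B⟨k,j⟩≡B⟨j,k⟩ m n k j l rewrite +-comm m n = refl

theorem2p7 : (m n k l : ℕ) → 1 ≤ k → k ≤ m ⊓ n → l ≤ k →
    # m n k l
      ≡ ∑[ 0 ⋯ k ∸ 1 ] (λ j → I (l ≤? j) * ∣B⟨j,k⟩∣ m n k j l)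
        + ∑[ 0 ⋯ k ∸ 1 ] (λ j → I (k ∸ l ≤? j) * ∣B⟨k,j⟩∣ m n k j l)
-- `m` and `n` are rewritten as `p + suc K` and `q + suc K`, the form in which paths are counted by
-- their exit from the square.
theorem2p7 m n (suc K) l _ k≤m⊓n l≤k = subst₂ Claim
  (m∸n+n≡m (m≤n⊓o⇒m≤n m n k≤m⊓n)) (m∸n+n≡m (m≤n⊓o⇒m≤o m n k≤m⊓n))
  (shifted (m ∸ suc K) (n ∸ suc K))
  where
  Claim : ℕ → ℕ → Set
  Claim m n = # m n (suc K) l
    ≡ ∑[ 0 ⋯ K ] (λ j → I (l ≤? j) * ∣B⟨j,k⟩∣ m n (suc K) j l)
      + ∑[ 0 ⋯ K ] (λ j → I (suc K ∸ l ≤? j) * ∣B⟨k,j⟩∣ m n (suc K) j l)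

  shifted : ∀ p q → Claim (p + suc K) (q + suc K)
  shifted p q = trans (#-by-exit K l l≤k p q) (sym (cong₂ _+_
    (∑-cong K (λ j j≤K → I*B⟨j,k⟩ p q l j≤K))
    (∑-cong K (λ j j≤K → trans
      (cong (I (suc K ∸ l ≤? j) *_) (B⟨k,j⟩≡B⟨j,k⟩ (p + suc K) (q + suc K) (suc K) j l))
      (I*B⟨j,k⟩ q p (suc K ∸ l) j≤K)))))
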